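{- (Extended Lucas Theorem.) Let $n$ be a prime, let $m \geq n$ be an integer and let $k$ be an integer with $0 \leq k \leq m$. Write $m=\sum_{i=0}^r m_i n^i$ and $k=\sum_{i=0}^r k_i n^i$ in base $n$, where $r$ is a suitable nonnegative integer and $0 \leq m_i < n$, $0 \leq k_i < n$ are integers for each $i=0,1,\dots,r$. For each $i$ set $t_i=\min\{k_i,\, m_i-k_i\}$ and define \[ \binom{m_i}{t_i}_n := \begin{cases} (-1)^{t_i} \binom{n-1-m_i+t_i}{n-1-m_i} , & \text{if } m_i+t_i > n- 1,\\ (-1)^{t_i} \binom{n-1-m_i+t_i}{t_i}, & \text{if } m_i+t_i \leq n- 1 \text{ and } 2 m_i > n-1 +t_i,\\ \binom{m_i}{t_i}, & \text{otherwise}. \end{cases} \] Then \[ \binom{m}{k} \equiv \binom{m_r}{t_r}_n \binom{m-m_r n^r}{k-k_r n^r} \pmod{n}, \] and moreover \[ \binom{m}{k} \equiv \binom{m_r}{t_r}_n \binom{m_{r-1}}{t_{r-1}}_n \cdots \binom{m_1}{t_1}_n \binom{m_0}{t_0}_n \pmod{n}. \]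
   Context: Binomial coefficients $\binom{a}{b}$ with integer $a\ge 0$ follow the usual convention that $\binom{a}{b}=0$ if $b<0$ or $b>a$. -}

module Defs where

open import Data.Bool.Base using (if_then_else_)
open import Data.Fin.Base using (toℕ)
open import Data.Integer.Base
  using (ℤ; +_; -[1+_]; 0ℤ; 1ℤ; -1ℤ; _+_; _-_; _*_; _^_; ∣_∣; _⊓_)
open import Data.Integer.Divisibility using (_∣_)
open import Data.Integer.Properties using (_<?_; *-1-commutativeMonoid)
open import Data.Nat.Base as ℕ using (ℕ; suc)
import Data.Nat.Combinatorics as ℕ
open import Data.Nat.Properties using (+-0-commutativeMonoid)
open import Data.Vec.Functional using (Vector)
open import Relation.Binary.PropositionalEquality.Core using (_≡_)
open import Relation.Nullary.Decidable.Core using (does)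

open import Algebra.Properties.CommutativeMonoid.Sum +-0-commutativeMonoid
  using (sum⁺-syntax)
import Algebra.Properties.CommutativeMonoid.Sum *-1-commutativeMonoid as Product

infix 4 _≡_[mod_]

_≡_[mod_] : ℤ → ℤ → ℕ → Set
a ≡ b [mod n ] = + n ∣ a - b

-- The binomial coefficient is only meant for upper index ≥ 0; the value 0 for
-- a negative upper index is a dummy one. The library's  a C b  is already 0
-- for b > a.
binom : ℤ → ℤ → ℤ
binom (+ a)    (+ b)    = + (a ℕ.C b)
binom (+ a)    -[1+ b ] = 0ℤ
binom -[1+ a ] b        = 0ℤ

-- (-1)^t for an integer t: since -1 is its own inverse, (-1)^t = (-1)^∣t∣.
sign^ : ℤ → ℤ
sign^ t = -1ℤ ^ ∣ t ∣

-- The modified binomial (m over t)_n. The inner test is reached only when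
-- m + t ≤ n - 1. For t = min {k , m - k} with 0 ≤ k, m < n, all upper indices
-- below are nonnegative, even if t is negative (k > m): then
-- n - 1 - m + t = n - 1 - k.
binomₙ : ℕ → ℤ → ℤ → ℤ
binomₙ n m t =
  if does (n-1 <? m + t)
    then sign^ t * binom (n-1 - m + t) (n-1 - m)
  else if does (n-1 + t <? + 2 * m)
    then sign^ t * binom (n-1 - m + t) t
  else binom m t
  where
  n-1 : ℤ
  n-1 = + n - 1ℤ

record IsExpansion (n r : ℕ) (d : Vector ℕ (suc r)) (m : ℕ) : Set where
  field
    digit< : ∀ i → d i ℕ.< n
    sum≡   : m ≡ ∑[ i ≤ r ] (d i ℕ.* n ℕ.^ toℕ i)

∏ : ∀ {r} → Vector ℤ r → ℤ
∏ = Product.sum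

-- min {k , m - k}, taken in ℤ because a digit of k may exceed that of m.
tMin : ℕ → ℕ → ℤ
tMin m k = + k ⊓ (+ m - + k)

{-# OPTIONS --safe #-}
-- Lucas' theorem C(n q + a, n s + b) ≡ C(q, s) C(a, b) follows by induction on
-- the upper index from Pascal's rule alone, the carry being absorbed by
-- n ∣ C(n, j) for 0 < j < n. The modified binomials agree with the ordinary ones
-- modulo n: C(m, t) ≡ C(m - n, t) = (-1)^t C(n - 1 - m + t, t).
module Submission where

open import Data.Bool.Base using (true; false)
open import Data.Fin.Base using (fromℕ; inject₁; toℕ; zero; suc)
open import Data.Fin.Properties using (toℕ-fromℕ; toℕ-inject₁)
open import Data.Integer.Base
  using (ℤ; +_; -[1+_]; 0ℤ; 1ℤ; -1ℤ; _+_; _-_; _*_; _^_; _⊖_; -_; +<+)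
import Data.Integer.Base as ℤ
import Data.Integer.Divisibility.Signed as Signed
import Data.Integer.Properties as ℤ
open import Data.Integer.Tactic.RingSolver using (solve-∀)
open import Data.Nat.Base as ℕ using (ℕ; zero; suc)
open import Data.Nat.Combinatorics
  using (_C_; k>n⇒nCk≡0; nCk≡nC[n∸k]; nCn≡1; nCk+nC[k+1]≡[n+1]C[k+1])
import Data.Nat.Divisibility as ℕ
open import Data.Nat.Primality using (Prime; euclidsLemma; prime⇒nonZero)
import Data.Nat.Properties as ℕ
import Data.Nat.Tactic.RingSolver as ℕRing
open import Data.Product.Base using (_×_; _,_; ∃)
open import Data.Sum.Base using (inj₁; inj₂)
open import Data.Vec.Functional using (Vector; init; last; tail)
open import Function.Base using (_∘_)
open import Level using (0ℓ)
open import Relation.Binary.Bundles using (Setoid)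
open import Relation.Binary.PropositionalEquality
  using (_≡_; refl; sym; trans; cong; cong₂; subst; subst₂; module ≡-Reasoning)
import Relation.Binary.Reasoning.Setoid as SetoidReasoning
open import Relation.Nullary.Negation.Core using (contradiction)
open import Relation.Nullary.Decidable.Core using (does; yes; no)

open import Algebra.Properties.CommutativeMonoid.Sum ℕ.+-0-commutativeMonoid
  using (sum; sum-cong-≗; sum-init-last)
open import Algebra.Properties.Semiring.Sum ℕ.+-*-semiring using (*-distribˡ-sum)
import Algebra.Properties.CommutativeMonoid.Sum ℤ.*-1-commutativeMonoid as Product
open import Defs

-- Binomial coefficients

-- The absorption identity, by induction on `n`: Pascal's rule splits the left side, and once one
-- copy of `x` is set aside both remaining terms are instances of the induction hypothesis.
[1+k]*[1+n]C[1+k]≡[1+n]*nCk : ∀ n k → suc k ℕ.* (suc n C suc k) ≡ suc n ℕ.* (n C k)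
[1+k]*[1+n]C[1+k]≡[1+n]*nCk zero    zero    = refl
[1+k]*[1+n]C[1+k]≡[1+n]*nCk zero    (suc k) = ℕ.*-zeroʳ (2 ℕ.+ k)
[1+k]*[1+n]C[1+k]≡[1+n]*nCk (suc n) zero    = begin
  1 ℕ.* (suc (suc n) C 1)           ≡⟨ ℕ.*-identityˡ _ ⟩
  suc (suc n) C 1                   ≡⟨ nCk+nC[k+1]≡[n+1]C[k+1] (suc n) 0 ⟨
  suc (suc n C 1)                   ≡⟨ cong suc (ℕ.*-identityˡ _) ⟨
  suc (1 ℕ.* (suc n C 1))           ≡⟨ cong suc ([1+k]*[1+n]C[1+k]≡[1+n]*nCk n 0) ⟩
  suc (suc n ℕ.* 1)                 ∎
  where open ≡-Reasoning
[1+k]*[1+n]C[1+k]≡[1+n]*nCk (suc n) (suc k) = begin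
  suc (suc k) ℕ.* (suc (suc n) C suc (suc k))
    ≡⟨ cong (suc (suc k) ℕ.*_) (nCk+nC[k+1]≡[n+1]C[k+1] (suc n) (suc k)) ⟨
  suc (suc k) ℕ.* (x ℕ.+ y)
    ≡⟨ regroup k x y ⟩
  x ℕ.+ (suc k ℕ.* x ℕ.+ suc (suc k) ℕ.* y)
    ≡⟨ cong (x ℕ.+_) (cong₂ ℕ._+_ ([1+k]*[1+n]C[1+k]≡[1+n]*nCk n k)
                                  ([1+k]*[1+n]C[1+k]≡[1+n]*nCk n (suc k))) ⟩
  x ℕ.+ (suc n ℕ.* (n C k) ℕ.+ suc n ℕ.* (n C suc k))
    ≡⟨ cong (x ℕ.+_) (ℕ.*-distribˡ-+ (suc n) (n C k) (n C suc k)) ⟨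
  x ℕ.+ suc n ℕ.* (n C k ℕ.+ n C suc k)
    ≡⟨ cong (λ z → x ℕ.+ suc n ℕ.* z) (nCk+nC[k+1]≡[n+1]C[k+1] n k) ⟩
  suc (suc n) ℕ.* x
    ∎
  where
  open ≡-Reasoning
  x = suc n C suc k
  y = suc n C suc (suc k)
  regroup : ∀ k x y → suc (suc k) ℕ.* (x ℕ.+ y)
                    ≡ x ℕ.+ (suc k ℕ.* x ℕ.+ suc (suc k) ℕ.* y)
  regroup = ℕRing.solve-∀

-- By absorption `n` divides the product of `suc j` and the coefficient. It cannot divide the
-- smaller positive number `suc j`, so Euclid's lemma leaves the coefficient.
prime∣C : ∀ {n j} → Prime n → suc j ℕ.< n → n ℕ.∣ n C suc j
prime∣C {suc n} {j} pr j<n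
  with euclidsLemma (suc j) (suc n C suc j) pr
         (subst (suc n ℕ.∣_) (sym ([1+k]*[1+n]C[1+k]≡[1+n]*nCk n j)) (ℕ.m∣m*n (n C j)))
... | inj₁ n∣1+j = contradiction n∣1+j (ℕ.>⇒∤ j<n)
... | inj₂ n∣C   = n∣C

[m+n]Cm≡[m+n]Cn : ∀ m n → (m ℕ.+ n) C m ≡ (m ℕ.+ n) C n
[m+n]Cm≡[m+n]Cn m n =
  trans (nCk≡nC[n∸k] (ℕ.m≤m+n m n)) (cong ((m ℕ.+ n) C_) (ℕ.m+n∸m≡n m n))

-- For negative `a` the dummy value of `binom` supplies the zero.
binom-< : ∀ a {b} → a ℤ.< + b → binom a (+ b) ≡ 0ℤ
binom-< (+ a)    (+<+ a<b) = cong +_ (k>n⇒nCk≡0 a<b)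
binom-< -[1+ a ] _         = refl

binom-neg : ∀ a b → binom a -[1+ b ] ≡ 0ℤ
binom-neg (+ a)    b = refl
binom-neg -[1+ a ] b = refl

-- By symmetry both candidates for the minimum, `k` and `m - k`, give the same binomial coefficient.
tMin-≤ : ∀ {m k} → k ℕ.≤ m → ∃ λ t → tMin m k ≡ + t × t ℕ.≤ m × m C t ≡ m C k
tMin-≤ {m} {k} k≤m
  rewrite trans (ℤ.[+m]-[+n]≡m⊖n m k) (ℤ.⊖-≥ k≤m)
  with ℕ.⊓-sel k (m ℕ.∸ k)
... | inj₁ eq = k , cong +_ eq , k≤m , refl
... | inj₂ eq = m ℕ.∸ k , cong +_ eq , ℕ.m∸n≤m m k , sym (nCk≡nC[n∸k] k≤m)

-- When `k` exceeds `m` by `j + 1`, the difference `m - k` is negative and hence the minimum.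
tMin-> : ∀ m j → tMin m (suc (m ℕ.+ j)) ≡ -[1+ j ]
tMin-> m j = cong (+ suc (m ℕ.+ j) ℤ.⊓_) (begin
  m ⊖ suc (m ℕ.+ j)            ≡⟨ cong₂ _⊖_ (ℕ.+-identityʳ m) (ℕ.+-suc m j) ⟨
  (m ℕ.+ 0) ⊖ (m ℕ.+ suc j)    ≡⟨ ℤ.+-cancelˡ-⊖ m 0 (suc j) ⟩
  -[1+ j ]                     ∎)
  where open ≡-Reasoning

-- The premises carry no information about the tests, so `P` has to be established on all three
-- branch values.
binomₙ-elim : ∀ (P : ℤ → Set) n m t → let n-1 = + n - 1ℤ in
              P (sign^ t * binom (n-1 - m + t) (n-1 - m)) →
              P (sign^ t * binom (n-1 - m + t) t) →
              P (binom m t) →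
              P (binomₙ n m t)
binomₙ-elim P n m t p q r
  with does (+ n - 1ℤ ℤ.<? m + t) | does (+ n - 1ℤ + t ℤ.<? + 2 * m)
... | true  | _     = p
... | false | true  = q
... | false | false = r

-- Congruences

module Modulo (n : ℕ) where

  infix 4 _≈_

  -- A record because _≡_[mod_] unfolds to a divisibility from which a and b
  -- cannot be inferred.
  record _≈_ (a b : ℤ) : Set where
    constructor congruent
    field n∣a-b : + n Signed.∣ a - b

  ≈⇒≡mod : ∀ {a b} → a ≈ b → a ≡ b [mod n ]
  ≈⇒≡mod (congruent n∣a-b) = Signed.∣⇒∣ᵤ n∣a-b

  ≈-reflexive : ∀ {a b} → a ≡ b → a ≈ b
  ≈-reflexive {a} refl = congruent (Signed.divides 0ℤ (ℤ.+-inverseʳ a))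

  ≈-refl : ∀ {a} → a ≈ a
  ≈-refl = ≈-reflexive refl

  ≈-sym : ∀ {a b} → a ≈ b → b ≈ a
  ≈-sym {a} {b} (congruent p) = congruent (subst (+ n Signed.∣_) (eq a b) (Signed.∣m⇒∣-m p))
    where
    eq : ∀ a b → - (a - b) ≡ b - a
    eq = solve-∀

  ≈-trans : ∀ {a b c} → a ≈ b → b ≈ c → a ≈ c
  ≈-trans {a} {b} {c} (congruent p) (congruent q) =
    congruent (subst (+ n Signed.∣_) (eq a b c) (Signed.∣m∣n⇒∣m+n p q))
    where
    eq : ∀ a b c → a - b + (b - c) ≡ a - c
    eq = solve-∀

  +-cong : ∀ {a b c d} → a ≈ b → c ≈ d → a + c ≈ b + d
  +-cong {a} {b} {c} {d} (congruent p) (congruent q) =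
    congruent (subst (+ n Signed.∣_) (eq a b c d) (Signed.∣m∣n⇒∣m+n p q))
    where
    eq : ∀ a b c d → a - b + (c - d) ≡ a + c - (b + d)
    eq = solve-∀

  *-cong : ∀ {a b c d} → a ≈ b → c ≈ d → a * c ≈ b * d
  *-cong {a} {b} {c} {d} (congruent p) (congruent q) =
    congruent (subst (+ n Signed.∣_) (eq a b c d)
      (Signed.∣m∣n⇒∣m+n (Signed.∣m⇒∣m*n c p) (Signed.∣n⇒∣m*n b q)))
    where
    eq : ∀ a b c d → (a - b) * c + b * (c - d) ≡ a * c - b * d
    eq = solve-∀

  *-congˡ : ∀ {a b} c → a ≈ b → c * a ≈ c * b
  *-congˡ c = *-cong (≈-refl {c})

  ∣⇒≈0 : ∀ {a} → n ℕ.∣ a → + a ≈ 0ℤ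
  ∣⇒≈0 {a} n∣a =
    congruent (subst (+ n Signed.∣_) (sym (ℤ.+-identityʳ (+ a))) (Signed.∣ᵤ⇒∣ n∣a))

  ≈-setoid : Setoid 0ℓ 0ℓ
  ≈-setoid = record
    { _≈_           = _≈_
    ; isEquivalence = record { refl = ≈-refl ; sym = ≈-sym ; trans = ≈-trans }
    }

  module ≈-Reasoning = SetoidReasoning ≈-setoid

  ∏-cong : ∀ {ℓ} {f g : Vector ℤ ℓ} → (∀ i → f i ≈ g i) → ∏ f ≈ ∏ g
  ∏-cong {zero}  f≈g = ≈-refl
  ∏-cong {suc ℓ} f≈g = *-cong (f≈g zero) (∏-cong (f≈g ∘ suc))

  -- Lets an inductive step replace both summands of Pascal's rule by their known residues.
  pascal : ∀ x y {u v} → + (x C y) ≈ + u → + (x C suc y) ≈ + v →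
           + (suc x C suc y) ≈ + (u ℕ.+ v)
  pascal x y p q =
    ≈-trans (≈-reflexive (cong +_ (sym (nCk+nC[k+1]≡[n+1]C[k+1] x y)))) (+-cong p q)

-- Lucas' theorem

-- The digit vector may be empty, which gives inductions a base case; length `suc r` is the sum in
-- `IsExpansion`.
fromDigits : ∀ {ℓ} → ℕ → Vector ℕ ℓ → ℕ
fromDigits {ℓ} n d = sum {ℓ} (λ i → d i ℕ.* n ℕ.^ toℕ i)

-- Horner's step: splitting off the lowest digit produces the shape `a + n * q` on which Lucas'
-- theorem recurses.
fromDigits-suc : ∀ {ℓ} n (d : Vector ℕ (suc ℓ)) →
                 fromDigits n d ≡ d zero ℕ.+ n ℕ.* fromDigits n (tail d)
fromDigits-suc {ℓ} n d = cong₂ ℕ._+_ (ℕ.*-identityʳ (d zero))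
  (trans (sum-cong-≗ {ℓ} (λ i → swap (d (suc i)) n _)) (sym (*-distribˡ-sum {ℓ} n _)))
  where
  swap : ∀ a b c → a ℕ.* (b ℕ.* c) ≡ b ℕ.* (a ℕ.* c)
  swap = ℕRing.solve-∀

fromDigits-init-last : ∀ {r} n (d : Vector ℕ (suc r)) →
  fromDigits n d ≡ fromDigits n (init d) ℕ.+ last d ℕ.* n ℕ.^ r
fromDigits-init-last {r} n d = trans (sum-init-last (λ i → d i ℕ.* n ℕ.^ toℕ i)) (cong₂ ℕ._+_
  (sum-cong-≗ {r} (λ i → cong (λ e → d (inject₁ i) ℕ.* n ℕ.^ e) (toℕ-inject₁ i)))
  (cong (λ e → last d ℕ.* n ℕ.^ e) (toℕ-fromℕ r)))

-- Writing the modulus as `suc N` names the largest digit `N`, the one that appears after a borrow.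
module Lucas {N : ℕ} (pr : Prime (suc N)) where

  private
    n = suc N
    open Modulo n

  lucas-step : ∀ q a → a ℕ.< n → ∀ s b → b ℕ.< n →
               + ((a ℕ.+ n ℕ.* q) C (b ℕ.+ n ℕ.* s)) ≈ + ((a C b) ℕ.* (q C s))
  lucas-step q a a<n zero zero b<n rewrite ℕ.*-zeroʳ n = ≈-refl
  lucas-step zero zero a<n (suc s) zero b<n rewrite ℕ.*-zeroʳ n = ≈-refl
  lucas-step zero zero a<n s (suc b) b<n rewrite ℕ.*-zeroʳ n = ≈-refl
  -- Both indices borrow. The digit factors in the two Pascal terms are `N C N` and `N C 0`, both 1,
  -- so Pascal's rule applies to `q` and `s`.
  lucas-step (suc q) zero a<n (suc s) zero b<n = begin
    + ((n ℕ.* suc q) C (n ℕ.* suc s))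
      ≡⟨ cong₂ (λ x y → + (x C y)) (ℕ.*-suc n q) (ℕ.*-suc n s) ⟩
    + (suc (N ℕ.+ n ℕ.* q) C suc (N ℕ.+ n ℕ.* s))
      ≈⟨ pascal (N ℕ.+ n ℕ.* q) (N ℕ.+ n ℕ.* s)
           (lucas-step q N (ℕ.n<1+n N) s N (ℕ.n<1+n N))
           (subst (λ y → + ((N ℕ.+ n ℕ.* q) C y) ≈ + (1 ℕ.* (q C suc s)))
             (ℕ.*-suc n s) (lucas-step q N (ℕ.n<1+n N) (suc s) 0 b<n)) ⟩
    + ((N C N) ℕ.* (q C s) ℕ.+ 1 ℕ.* (q C suc s))
      ≡⟨ cong (λ z → + (z ℕ.* (q C s) ℕ.+ 1 ℕ.* (q C suc s))) (nCn≡1 N) ⟩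
    + (1 ℕ.* (q C s) ℕ.+ 1 ℕ.* (q C suc s))
      ≡⟨ cong +_ (ℕ.*-distribˡ-+ 1 (q C s) (q C suc s)) ⟨
    + (1 ℕ.* (q C s ℕ.+ q C suc s))
      ≡⟨ cong (λ z → + (1 ℕ.* z)) (nCk+nC[k+1]≡[n+1]C[k+1] q s) ⟩
    + (1 ℕ.* (suc q C suc s))
      ∎
    where open ≈-Reasoning
  lucas-step (suc q) zero a<n s (suc b) b<n = begin
    + ((n ℕ.* suc q) C suc (b ℕ.+ n ℕ.* s))
      ≡⟨ cong (λ x → + (x C suc (b ℕ.+ n ℕ.* s))) (ℕ.*-suc n q) ⟩
    + (suc (N ℕ.+ n ℕ.* q) C suc (b ℕ.+ n ℕ.* s))
      ≈⟨ pascal (N ℕ.+ n ℕ.* q) (b ℕ.+ n ℕ.* s)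
           (lucas-step q N (ℕ.n<1+n N) s b (ℕ.<⇒≤ b<n))
           (lucas-step q N (ℕ.n<1+n N) s (suc b) b<n) ⟩
    + ((N C b) ℕ.* (q C s) ℕ.+ (N C suc b) ℕ.* (q C s))
      ≡⟨ cong +_ (ℕ.*-distribʳ-+ (q C s) (N C b) (N C suc b)) ⟨
    + ((N C b ℕ.+ N C suc b) ℕ.* (q C s))
      ≡⟨ cong (λ z → + (z ℕ.* (q C s))) (nCk+nC[k+1]≡[n+1]C[k+1] N b) ⟩
    + ((n C suc b) ℕ.* (q C s))
      -- Only the upper index borrowed, so the digit factors recombine to `n C suc b`. Primality
      -- makes it vanish, matching `0 C suc b` in the claim.
      ≈⟨ ∣⇒≈0 (ℕ.∣m⇒∣m*n (q C s) (prime∣C pr b<n)) ⟩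
    0ℤ
      ∎
    where open ≈-Reasoning
  lucas-step q (suc a) a<n (suc s) zero b<n = begin
    + (suc (a ℕ.+ n ℕ.* q) C (n ℕ.* suc s))
      ≡⟨ cong (λ y → + (suc (a ℕ.+ n ℕ.* q) C y)) (ℕ.*-suc n s) ⟩
    + (suc (a ℕ.+ n ℕ.* q) C suc (N ℕ.+ n ℕ.* s))
      ≈⟨ pascal (a ℕ.+ n ℕ.* q) (N ℕ.+ n ℕ.* s)
           (lucas-step q a (ℕ.<⇒≤ a<n) s N (ℕ.n<1+n N))
           (subst (λ y → + ((a ℕ.+ n ℕ.* q) C y) ≈ + (1 ℕ.* (q C suc s)))
             (ℕ.*-suc n s) (lucas-step q a (ℕ.<⇒≤ a<n) (suc s) 0 b<n)) ⟩
    + ((a C N) ℕ.* (q C s) ℕ.+ 1 ℕ.* (q C suc s))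
      -- Only the lower index borrowed, and `a < N` makes the term with lower digit `N` vanish.
      ≡⟨ cong (λ z → + (z ℕ.* (q C s) ℕ.+ 1 ℕ.* (q C suc s))) (k>n⇒nCk≡0 (ℕ.s≤s⁻¹ a<n)) ⟩
    + (1 ℕ.* (q C suc s))
      ∎
    where open ≈-Reasoning
  lucas-step q (suc a) a<n s (suc b) b<n = begin
    + (suc (a ℕ.+ n ℕ.* q) C suc (b ℕ.+ n ℕ.* s))
      ≈⟨ pascal (a ℕ.+ n ℕ.* q) (b ℕ.+ n ℕ.* s)
           (lucas-step q a (ℕ.<⇒≤ a<n) s b (ℕ.<⇒≤ b<n))
           (lucas-step q a (ℕ.<⇒≤ a<n) s (suc b) b<n) ⟩
    + ((a C b) ℕ.* (q C s) ℕ.+ (a C suc b) ℕ.* (q C s))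
      ≡⟨ cong +_ (ℕ.*-distribʳ-+ (q C s) (a C b) (a C suc b)) ⟨
    + ((a C b ℕ.+ a C suc b) ℕ.* (q C s))
      ≡⟨ cong (λ z → + (z ℕ.* (q C s))) (nCk+nC[k+1]≡[n+1]C[k+1] a b) ⟩
    + ((suc a C suc b) ℕ.* (q C s))
      ∎
    where open ≈-Reasoning

  lucas : ∀ {ℓ} (d e : Vector ℕ ℓ) → (∀ i → d i ℕ.< n) → (∀ i → e i ℕ.< n) →
          + (fromDigits n d C fromDigits n e) ≈ ∏ (λ i → + (d i C e i))
  lucas {zero}  d e d< e< = ≈-refl
  lucas {suc ℓ} d e d< e< = begin
    + (fromDigits n d C fromDigits n e)
      ≡⟨ cong₂ (λ x y → + (x C y)) (fromDigits-suc n d) (fromDigits-suc n e) ⟩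
    + ((d zero ℕ.+ n ℕ.* x) C (e zero ℕ.+ n ℕ.* y))
      ≈⟨ lucas-step x (d zero) (d< zero) y (e zero) (e< zero) ⟩
    + ((d zero C e zero) ℕ.* (x C y))
      ≡⟨ ℤ.pos-* (d zero C e zero) (x C y) ⟩
    + (d zero C e zero) * + (x C y)
      ≈⟨ *-congˡ (+ (d zero C e zero))
           (lucas (tail d) (tail e) (d< ∘ suc) (e< ∘ suc)) ⟩
    ∏ (λ i → + (d i C e i))
      ∎
    where
    open ≈-Reasoning
    x = fromDigits n (tail d)
    y = fromDigits n (tail e)

  -- Modified binomial coefficients modulo `n`

  -- C(m, t + 1) = C(m + 1, t + 1) - C(m, t), and the right-hand side is known
  -- from smaller p or t; for p = 0 the minuend is C(n, t + 1) ≡ 0.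
  upper-negation : ∀ p m t → m ℕ.+ p ≡ N → t ℕ.< n →
                   -1ℤ ^ t * + ((p ℕ.+ t) C t) ≈ + (m C t)
  upper-negation p m zero    eq t<n = ≈-refl
  upper-negation zero m (suc t) eq t<n rewrite trans (sym (ℕ.+-identityʳ m)) eq = begin
    -1ℤ ^ suc t * + (suc t C suc t)
      ≡⟨ cong (λ z → -1ℤ ^ suc t * + z) (trans (nCn≡1 (suc t)) (sym (nCn≡1 t))) ⟩
    -1ℤ * -1ℤ ^ t * + (t C t)
      ≡⟨ ring (-1ℤ ^ t) (+ (t C t)) ⟩
    0ℤ + -1ℤ * (-1ℤ ^ t * + (t C t))
      ≈⟨ +-cong (≈-sym (∣⇒≈0 (prime∣C pr t<n)))
           (*-congˡ -1ℤ (upper-negation zero N t (ℕ.+-identityʳ N) (ℕ.<⇒≤ t<n))) ⟩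
    + (n C suc t) + -1ℤ * + (N C t)
      ≡⟨ cong (λ z → + z + -1ℤ * + (N C t)) (nCk+nC[k+1]≡[n+1]C[k+1] N t) ⟨
    + (N C t) + + (N C suc t) + -1ℤ * + (N C t)
      ≡⟨ cancel (+ (N C t)) (+ (N C suc t)) ⟩
    + (N C suc t)
      ∎
    where
    open ≈-Reasoning
    ring : ∀ x y → -1ℤ * x * y ≡ 0ℤ + -1ℤ * (x * y)
    ring = solve-∀
    cancel : ∀ x y → x + y + -1ℤ * x ≡ y
    cancel = solve-∀
  upper-negation (suc p) m (suc t) eq t<n = begin
    -1ℤ ^ suc t * + (suc (p ℕ.+ suc t) C suc t)
      ≡⟨ cong (λ z → -1ℤ ^ suc t * + z) (nCk+nC[k+1]≡[n+1]C[k+1] (p ℕ.+ suc t) t) ⟨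
    -1ℤ ^ suc t * + ((p ℕ.+ suc t) C t ℕ.+ (p ℕ.+ suc t) C suc t)
      ≡⟨ ring (-1ℤ ^ t) (+ ((p ℕ.+ suc t) C t)) (+ ((p ℕ.+ suc t) C suc t)) ⟩
    -1ℤ ^ suc t * + ((p ℕ.+ suc t) C suc t) + -1ℤ * (-1ℤ ^ t * + ((p ℕ.+ suc t) C t))
      ≡⟨ cong (λ z → -1ℤ ^ suc t * + ((p ℕ.+ suc t) C suc t) + -1ℤ * (-1ℤ ^ t * + (z C t)))
           (ℕ.+-suc p t) ⟩
    -1ℤ ^ suc t * + ((p ℕ.+ suc t) C suc t) + -1ℤ * (-1ℤ ^ t * + ((suc p ℕ.+ t) C t))
      ≈⟨ +-cong
           (upper-negation p (suc m) (suc t) (trans (sym (ℕ.+-suc m p)) eq) t<n)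
           (*-congˡ -1ℤ (upper-negation (suc p) m t eq (ℕ.<⇒≤ t<n))) ⟩
    + (suc m C suc t) + -1ℤ * + (m C t)
      ≡⟨ cong (λ z → + z + -1ℤ * + (m C t)) (nCk+nC[k+1]≡[n+1]C[k+1] m t) ⟨
    + (m C t) + + (m C suc t) + -1ℤ * + (m C t)
      ≡⟨ cancel (+ (m C t)) (+ (m C suc t)) ⟩
    + (m C suc t)
      ∎
    where
    open ≈-Reasoning
    ring : ∀ x y z → -1ℤ * x * (y + z) ≡ -1ℤ * x * z + -1ℤ * (x * y)
    ring = solve-∀
    cancel : ∀ x y → x + y + -1ℤ * x ≡ y
    cancel = solve-∀

  -- All three branches of the definition are congruent to C(m, k), so its
  -- conditions need not be evaluated.
  binomₙ-tMin : ∀ m k → m ℕ.< n → binomₙ n (+ m) (tMin m k) ≈ + (m C k)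
  binomₙ-tMin m k m<n with k ℕ.≤? m
  ... | yes k≤m with t , eq , t≤m , mCt≡mCk ← tMin-≤ k≤m =
    subst₂ (λ z c → binomₙ n (+ m) z ≈ + c) (sym eq) mCt≡mCk
      (binomₙ-elim (_≈ + (m C t)) n (+ m) (+ t) branch₁ branch₂ ≈-refl)
    where
    p = N ℕ.∸ m
    m≤N = ℕ.s≤s⁻¹ m<n
    n-1-m : + n - 1ℤ - + m ≡ + p
    n-1-m = trans (ℤ.[+m]-[+n]≡m⊖n N m) (ℤ.⊖-≥ m≤N)
    negated : -1ℤ ^ t * + ((p ℕ.+ t) C t) ≈ + (m C t)
    negated = upper-negation p m t (ℕ.m+[n∸m]≡n m≤N) (ℕ.≤-<-trans t≤m m<n)
    branch₂ : sign^ (+ t) * binom (+ n - 1ℤ - + m + + t) (+ t) ≈ + (m C t)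
    branch₂ = ≈-trans
      (≈-reflexive (cong (λ z → sign^ (+ t) * binom (z + + t) (+ t)) n-1-m)) negated
    branch₁ : sign^ (+ t) * binom (+ n - 1ℤ - + m + + t) (+ n - 1ℤ - + m) ≈ + (m C t)
    branch₁ = ≈-trans
      (≈-reflexive (trans (cong (λ z → sign^ (+ t) * binom (z + + t) z) n-1-m)
                          -- Symmetry exchanges the lower index `p` for `t`, which turns the first
                          -- branch into the second.
                          (cong (λ z → sign^ (+ t) * + z) ([m+n]Cm≡[m+n]Cn p t)))) negated
  -- For `k > m` every branch is zero: the second and third have a negative lower index, and in the
  -- first the upper index lies `j + 1` below the lower index `p`.
  binomₙ-tMin m k m<n | no k≰m
    with j , refl ← ℕ.m≤n⇒∃[o]m+o≡n (ℕ.≰⇒> k≰m) =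
    subst₂ (λ z c → binomₙ n (+ m) z ≈ + c) (sym (tMin-> m j)) (sym (k>n⇒nCk≡0 (ℕ.≰⇒> k≰m)))
      (binomₙ-elim (_≈ 0ℤ) n (+ m) -[1+ j ] branch₁ branch₂ ≈-refl)
    where
    p = N ℕ.∸ m
    n-1-m : + n - 1ℤ - + m ≡ + p
    n-1-m = trans (ℤ.[+m]-[+n]≡m⊖n N m) (ℤ.⊖-≥ (ℕ.s≤s⁻¹ m<n))
    *0 : ∀ {x} → x ≡ 0ℤ → sign^ -[1+ j ] * x ≈ 0ℤ
    *0 refl = ≈-reflexive (ℤ.*-zeroʳ (sign^ -[1+ j ]))
    branch₂ : sign^ -[1+ j ] * binom (+ n - 1ℤ - + m + -[1+ j ]) -[1+ j ] ≈ 0ℤ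
    branch₂ = *0 (binom-neg (+ n - 1ℤ - + m + -[1+ j ]) j)
    branch₁ : sign^ -[1+ j ] * binom (+ n - 1ℤ - + m + -[1+ j ]) (+ n - 1ℤ - + m) ≈ 0ℤ
    branch₁ = *0 (trans (cong (λ z → binom (z + -[1+ j ]) z) n-1-m)
                        (binom-< (+ p + -[1+ j ]) (ℤ.m⊖1+n<m p (suc j))))

theorem1p2 : (n : ℕ) → Prime n →
    (m : ℕ) → n ℕ.≤ m →
    (k : ℕ) → k ℕ.≤ m →
    (r : ℕ) (mᵢ kᵢ : Vector ℕ (suc r)) →
    IsExpansion n r mᵢ m →
    IsExpansion n r kᵢ k →
    let top = fromℕ r
        factor = λ i → binomₙ n (+ mᵢ i) (tMin (mᵢ i) (kᵢ i))
    in
    (binom (+ m) (+ k)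
      ≡ factor top * binom (+ m - + (mᵢ top ℕ.* n ℕ.^ r)) (+ k - + (kᵢ top ℕ.* n ℕ.^ r)) [mod n ])
    × (binom (+ m) (+ k) ≡ ∏ factor [mod n ])
theorem1p2 zero pr = contradiction refl (ℕ.≢-nonZero⁻¹ 0 {{prime⇒nonZero pr}})
-- Matching `sum≡` with `refl` turns `m` and `k` into `fromDigits n mᵢ` and `fromDigits n kᵢ`.
theorem1p2 (suc N) pr m _ k _ r mᵢ kᵢ
  record { digit< = m< ; sum≡ = refl } record { digit< = k< ; sum≡ = refl } =
  -- The first congruence follows from the second: the top factor is split off, and Lucas' theorem
  -- for the lower digits collects the other factors into one binomial coefficient.
  ≈⇒≡mod (begin
    + (m C k)
      ≈⟨ product-formula ⟩
    ∏ factor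
      ≡⟨ Product.sum-init-last factor ⟩
    ∏ (init factor) * last factor
      ≡⟨ ℤ.*-comm _ (last factor) ⟩
    last factor * ∏ (init factor)
      ≈⟨ *-congˡ (last factor) lower-digits ⟩
    last factor * + (m′ C k′)
      ≡⟨ cong₂ (λ x y → last factor * binom x y) (drop-last mᵢ) (drop-last kᵢ) ⟨
    last factor * binom (+ m - + (last mᵢ ℕ.* n ℕ.^ r)) (+ k - + (last kᵢ ℕ.* n ℕ.^ r))
      ∎)
  , ≈⇒≡mod product-formula
  where
  n = suc N
  open Modulo n
  open Lucas pr
  open ≈-Reasoning

  factor : Vector ℤ (suc r)
  factor i = binomₙ n (+ mᵢ i) (tMin (mᵢ i) (kᵢ i))

  m′ = fromDigits n (init mᵢ)
  k′ = fromDigits n (init kᵢ)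

  factor≈C : ∀ i → factor i ≈ + (mᵢ i C kᵢ i)
  factor≈C i = binomₙ-tMin (mᵢ i) (kᵢ i) (m< i)

  product-formula : + (m C k) ≈ ∏ factor
  product-formula = ≈-trans (lucas mᵢ kᵢ m< k<) (≈-sym (∏-cong factor≈C))

  lower-digits : ∏ (init factor) ≈ + (m′ C k′)
  lower-digits = ≈-trans (∏-cong (factor≈C ∘ inject₁))
    (≈-sym (lucas (init mᵢ) (init kᵢ) (m< ∘ inject₁) (k< ∘ inject₁)))

  -- Shows the integer difference to be a natural number, at which `binom` computes to an ordinary
  -- coefficient.
  drop-last : (d : Vector ℕ (suc r)) →
              + fromDigits n d - + (last d ℕ.* n ℕ.^ r) ≡ + fromDigits n (init d)
  drop-last d = trans (cong (λ z → + z - + (last d ℕ.* n ℕ.^ r)) (fromDigits-init-last n d))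
    (cancel (+ fromDigits n (init d)) (+ (last d ℕ.* n ℕ.^ r)))
    where
    cancel : ∀ x y → x + y - y ≡ x
    cancel = solve-∀
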